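{- Let $t\ge 1$ be an integer and let $f:\mathbb{N}\to\mathbb{N}$ be a function with $f(1)=f(2)=f(3)=f(4)=f(5)=t$. Let $\mathcal{C}$ be the class of all graphs $H$ with $\mathrm{ltw}^H(r) \le f(r)$ for all $r\in\mathbb{N}$. Let $G$ be a graph on $n$ vertices which is the complement of a $c$-closed graph. Then the number of inclusion-maximal sets $S\subseteq V(G)$ with $G[S]\in\mathcal{C}$ is $O(n^{t+4}4^{c-1})$.
   Context: Graphs are finite, simple and undirected. A graph $H$ is $c$-closed if any two non-adjacent vertices have at most $c-1$ common neighbors; $G$ is the complement of a $c$-closed graph iff for any two adjacent vertices $u,v$ of $G$ at most $c-1$ vertices of $G$ are adjacent to neither $u$ nor $v$ (excluding $u,v$). For a graph $H$, a vertex $v$ and $r\in\mathbb{N}$, $N_r(v)$ is the set of vertices at distance at most $r$ from $v$ in $H$, and the local treewidth is $\mathrm{ltw}^H(r) = \max\{\mathrm{tw}(H[N_r(v)]) : v\in V(H)\}$, where $\mathrm{tw}$ denotes treewidth. -}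

module Defs where

open import Data.Nat using (ℕ; zero; suc; _+_; _*_; _∸_; _^_; _≤_; _<_)
open import Data.Bool using (Bool; true; false; not; _∧_; T)
open import Data.Fin using (Fin; zero; suc; inject₁; fromℕ; _≟_)
open import Data.Fin.Subset using (Subset; _∈_; _⊆_; _⊂_; ∣_∣)
open import Data.Vec using (tabulate)
open import Data.List using (List; length)
open import Data.List.Relation.Unary.All using (All)
open import Data.List.Relation.Unary.Unique.Propositional using (Unique)
open import Data.Product using (Σ; ∃; ∃-syntax; _×_; _,_)
open import Data.Unit using (⊤)
open import Function.Definitions using (Injective)
open import Relation.Nullary using (¬_; ⌊_⌋)
open import Relation.Binary.PropositionalEquality using (_≡_; _≢_)

record Graph (n : ℕ) : Set where
  field
    adj    : Fin n → Fin n → Bool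
    sym    : ∀ u v → adj u v ≡ adj v u
    irrefl : ∀ u → adj u u ≡ false
open Graph public

Edge : ∀ {n} → Graph n → Fin n → Fin n → Set
Edge G u v = T (adj G u v)

-- Walks in G all of whose vertices satisfy P, indexed by their length
-- (number of edges).  Walks inside P are walks in the induced subgraph G[P].

data Walk {n : ℕ} (G : Graph n) (P : Fin n → Set) : Fin n → Fin n → ℕ → Set where
  here : ∀ {x} → P x → Walk G P x x zero
  step : ∀ {x y z k} → P x → Edge G x y → Walk G P y z k → Walk G P x z (suc k)

record Cycle {m : ℕ} (T' : Graph m) : Set where
  field
    l      : ℕ
    long   : 2 ≤ l
    c      : Fin (suc l) → Fin m
    inj    : Injective _≡_ _≡_ c
    consec : ∀ (i : Fin l) → Edge T' (c (inject₁ i)) (c (suc i))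
    close  : Edge T' (c (fromℕ l)) (c zero)

Connected : ∀ {m} → Graph m → Set
Connected {m} T' = ∀ (x y : Fin m) → ∃[ k ] Walk T' (λ _ → ⊤) x y k

IsTree : ∀ {m} → Graph m → Set
IsTree {m} T' = (1 ≤ m) × Connected T' × ¬ Cycle T'

record TreeDecomposition {n : ℕ} (G : Graph n) (W : Fin n → Set) (k : ℕ) : Set where
  field
    m        : ℕ
    tree     : Graph m
    isTree   : IsTree tree
    bag      : Fin m → Subset n
    bag⊆W    : ∀ x u → u ∈ bag x → W u
    small    : ∀ x → ∣ bag x ∣ ≤ suc k
    vertices : ∀ u → W u → ∃[ x ] u ∈ bag x
    edges    : ∀ u v → W u → W v → Edge G u v → ∃[ x ] (u ∈ bag x × v ∈ bag x)
    coherent : ∀ u x y → u ∈ bag x → u ∈ bag y →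
               ∃[ j ] Walk tree (λ z → u ∈ bag z) x y j

TwAtMost : ∀ {n} → Graph n → (Fin n → Set) → ℕ → Set
TwAtMost G W k = TreeDecomposition G W k

Ball : ∀ {n} → Graph n → Subset n → Fin n → ℕ → Fin n → Set
Ball G S v r u = ∃[ k ] (k ≤ r × Walk G (λ z → z ∈ S) v u k)

LtwAtMost : ∀ {n} → Graph n → Subset n → ℕ → ℕ → Set
LtwAtMost G S r b = ∀ v → v ∈ S → TwAtMost G (Ball G S v r) b

InClass : (ℕ → ℕ) → ∀ {n} → Graph n → Subset n → Set
InClass f G S = ∀ r → LtwAtMost G S r (f r)

MaximalInClass : (ℕ → ℕ) → ∀ {n} → Graph n → Subset n → Set
MaximalInClass f G S = InClass f G S × (∀ S' → S ⊂ S' → ¬ InClass f G S')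

complementAdj : ∀ {n} → Graph n → Fin n → Fin n → Bool
complementAdj G u v = not (adj G u v) ∧ not ⌊ u ≟ v ⌋

commonNbrs : ∀ {n} → (Fin n → Fin n → Bool) → Fin n → Fin n → Subset n
commonNbrs a u v = tabulate (λ w → a u w ∧ a v w)

CClosed : ℕ → ∀ {n} → (Fin n → Fin n → Bool) → Set
CClosed c a = ∀ u v → u ≢ v → a u v ≡ false → ∣ commonNbrs a u v ∣ ≤ c ∸ 1

CoCClosed : ℕ → ∀ {n} → Graph n → Set
CoCClosed c G = CClosed c (complementAdj G)

NumMaximalAtMost : (ℕ → ℕ) → ∀ {n} → Graph n → ℕ → Set
NumMaximalAtMost f {n} G B =
  ∀ (L : List (Subset n)) → Unique L → All (MaximalInClass f G) L → length L ≤ B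

{-# OPTIONS --safe #-}
-- Write X(uv) for the set of vertices adjacent to neither end of an edge uv; it
-- has at most c - 1 elements.  Let s be the least value of f on [4, ∞).  If S is
-- in the class, then either S ⊆ X(uv) ∪ X(xy) for two edges uv and xy of S, or
-- all edges of G[S] lie in one ball of radius 4, which has a tree decomposition
-- of width s.  In the latter case suppose that every bag misses some edge of
-- G[S]; orient each node of the tree towards such an edge.  Some tree edge pq is
-- then oriented both ways, and as A = bag p ∩ bag q separates the two missed
-- edges uv and xy, S ∖ A ⊆ X(uv) ∪ X(xy); moreover |A| ≤ s.  So S is determined
-- by A, u, v, x, y and its traces on X(uv) and X(xy), which gives O(n^(s+4) 4^(c-1)).
-- Otherwise S ∖ B is independent for some bag B, and every vertex of S ∖ B has at
-- most s neighbours in B.  Conversely every B ∪ I with I independent and this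
-- bound has treewidth at most s (take a star with centre B), so for a maximal S
-- the set S ∖ B is a maximal independent set of a graph determined by B.  There
-- are at most 1 + n^2 2^(c-1) of those, by the argument of Fox, Roughgarden,
-- Seshadhri, Wei and Wein on maximal cliques of c-closed graphs.

module Submission where

open import Defs renaming (sym to adj-sym)
open import Data.Bool using (Bool; true; false; not; _∧_; T; if_then_else_)
open import Data.Bool.Properties using (T?; T-≡; T-∧)
open import Data.Empty using (⊥-elim)
open import Data.Fin using (Fin; zero; suc; _≟_; inject₁; fromℕ; toℕ)
open import Data.Fin.Properties using (any?; all?; injective⇒≤; pigeonhole; toℕ<n; toℕ-inject₁; toℕ-fromℕ; toℕ-injective)
open import Data.Fin.Subset using (Subset; _∈_; _∉_; _⊆_; ∣_∣; ⊥; _∪_; _∩_; _-_; ⁅_⁆; inside; outside; Nonempty; ∁)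
open import Data.Fin.Subset.Properties
open import Data.List using (List; []; _∷_; length; lookup; _++_; map; concatMap; filter; allFin)
import Data.List.Membership.DecPropositional as DecMembership
open import Data.List.Membership.Propositional using (lose) renaming (_∈_ to _∈ₗ_)
open import Data.List.Membership.Propositional.Properties using (∈-lookup; ∈-map⁺; ∈-++⁺ˡ; ∈-++⁺ʳ; ∈-concatMap⁺; ∈-allFin; ∈-filter⁺; ∈-filter⁻)
open import Data.List.Properties using (length-map; length-++; length-tabulate; length-filter)
open import Data.List.Relation.Unary.All as All using (All; []; _∷_)
open import Data.List.Relation.Unary.All.Properties using (¬Any⇒All¬)
open import Data.List.Relation.Unary.AllPairs using ([]; _∷_)
open import Data.List.Relation.Unary.Any using (here; there; index)
open import Data.List.Relation.Unary.Any.Properties using (lookup-index)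
open import Data.List.Relation.Unary.Unique.Propositional using (Unique)
open import Data.List.Relation.Unary.Unique.Propositional.Properties using (allFin⁺; filter⁺)
open import Data.Nat using (ℕ; zero; suc; _+_; _*_; _∸_; _^_; _≤_; _<_; z≤n; s≤s)
open import Data.Nat.GeneralisedArithmetic using (fold; fold-+)
open import Data.Nat.Induction using (<-rec)
open import Data.Nat.Properties hiding (_≟_)
open import Data.Nat.Solver using (module +-*-Solver)
open import Data.Product using (Σ; ∃-syntax; _×_; _,_; proj₁; proj₂)
open import Data.Sum using (_⊎_; inj₁; inj₂; [_,_]′)
open import Data.Unit using (tt)
open import Data.Vec using (tabulate; []; _∷_; here; there)
open import Data.Vec.Properties using (lookup∘tabulate; []=⇒lookup; lookup⇒[]=)
open import Function using (_∘_; id)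
open import Function.Bundles using (Equivalence)
open import Function.Definitions using (Injective)
open import Relation.Binary using (tri<; tri≈; tri>)
open import Relation.Binary.PropositionalEquality using (_≡_; _≢_; refl; sym; trans; cong; cong₂; subst; subst₂; module ≡-Reasoning)
open import Relation.Nullary using (¬_; Dec; yes; no; contradiction; does)
open import Relation.Nullary.Decidable using (map′; _×-dec_; _⊎-dec_; _→-dec_; ¬?; decidable-stable; toWitness; fromWitness; ⌊_⌋; dec-true; dec-false)

edge-sym : ∀ {n} (G : Graph n) {u v} → Edge G u v → Edge G v u
edge-sym G {u} {v} = subst T (adj-sym G u v)

edge-irrefl : ∀ {n} (G : Graph n) {u} → ¬ Edge G u u
edge-irrefl G {u} e = subst T (irrefl G u) e

lookup-injective : ∀ {A : Set} {xs : List A} → Unique xs → Injective _≡_ _≡_ (lookup xs)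
lookup-injective (_ ∷ _)   {zero}  {zero}  _  = refl
lookup-injective (x∉ ∷ _)  {zero}  {suc j} eq = contradiction eq (All.lookup x∉ (∈-lookup j))
lookup-injective (x∉ ∷ _)  {suc i} {zero}  eq = contradiction (sym eq) (All.lookup x∉ (∈-lookup i))
lookup-injective (_ ∷ uniq) {suc i} {suc j} eq = cong suc (lookup-injective uniq eq)

-- Walks and paths

module _ {m : ℕ} {T' : Graph m} where

  start : ∀ {P x z k} → Walk T' P x z k → P x
  start (here px)     = px
  start (step px _ _) = px

  end : ∀ {P x z k} → Walk T' P x z k → P z
  end (here px)    = px
  end (step _ _ w) = end w

  weaken : ∀ {P Q : Fin m → Set} → (∀ {z} → P z → Q z) →
           ∀ {x z k} → Walk T' P x z k → Walk T' Q x z k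
  weaken f (here px)     = here (f px)
  weaken f (step px e w) = step (f px) e (weaken f w)

  infixr 5 _⊕_
  _⊕_ : ∀ {P x y z j k} → Walk T' P x y j → Walk T' P y z k → Walk T' P x z (j + k)
  here _ ⊕ w′      = w′
  step px e w ⊕ w′ = step px e (w ⊕ w′)

  snoc : ∀ {P x y z k} → Walk T' P x y k → Edge T' y z → P z → Walk T' P x z (suc k)
  snoc (here px) e pz      = step px e (here pz)
  snoc (step px e w) e′ pz = step px e (snoc w e′ pz)

  reverse : ∀ {P x z k} → Walk T' P x z k → Walk T' P z x k
  reverse (here px)     = here px
  reverse (step px e w) = snoc (reverse w) (edge-sym T' e) px

  -- The recursion reaches the end of the walk first, so the visit to `p` found first on the way
  -- back is the last one; what follows it avoids `p`.
  departure : ∀ {P x z k} p → z ≢ p → Walk T' P x z k →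
              (∃[ j ] Walk T' (λ y → P y × y ≢ p) x z j) ⊎
              (∃[ a ] ∃[ j ] (Edge T' p a × Walk T' (λ y → P y × y ≢ p) a z j))
  departure p z≢p (here px) = inj₁ (zero , here (px , z≢p))
  departure {x = x} p z≢p (step px e w) with departure p z≢p w
  ... | inj₂ later = inj₂ later
  ... | inj₁ (j , w′) with x ≟ p
  ...   | yes refl = inj₂ (_ , j , e , w′)
  ...   | no x≢p   = inj₁ (suc j , step (px , x≢p) e w′)

  leave : ∀ {P p z k} → z ≢ p → Walk T' P p z k →
          ∃[ a ] ∃[ j ] (Edge T' p a × Walk T' (λ y → P y × y ≢ p) a z j)
  leave {p = p} z≢p w with departure p z≢p w
  ... | inj₁ (_ , w′) = contradiction refl (proj₂ (start w′))
  ... | inj₂ out      = out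

  -- The vertex list is an index, so that simplicity is `Unique xs` and a cycle can be read off with
  -- `lookup`.
  data Path : Fin m → Fin m → List (Fin m) → Set where
    stop : ∀ {x} → Path x x (x ∷ [])
    link : ∀ {x y z xs} → Edge T' x y → Path y z xs → Path x z (x ∷ xs)

  path-walk : ∀ {P x z xs} → Path x z xs → All P xs → ∃[ k ] Walk T' P x z k
  path-walk stop       (px ∷ [])  = zero , here px
  path-walk (link e π) (px ∷ pxs) = let k , w = path-walk π pxs in suc k , step px e w

  suffix : ∀ {P : Fin m → Set} {y x z xs} → x ∈ₗ xs → Path y z xs → Unique xs → All P xs →
           ∃[ ys ] (Path x z ys × Unique ys × All P ys)
  suffix (here refl) stop       u       ps       = _ , stop , u , ps
  suffix (here refl) (link e π) u       ps       = _ , link e π , u , ps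
  suffix (there x∈)  (link _ π) (_ ∷ u) (_ ∷ ps) = suffix x∈ π u ps

  erase-loops : ∀ {P x z k} → Walk T' P x z k → ∃[ xs ] (Path x z xs × Unique xs × All P xs)
  erase-loops (here px) = _ , stop , ([] ∷ []) , (px ∷ [])
  erase-loops {x = x} (step px e w) with erase-loops w
  ... | xs , π , u , ps with DecMembership._∈?_ _≟_ x xs
  -- A later visit to `x`: the path from there on already starts at `x`.
  ...   | yes x∈ = suffix x∈ π u ps
  ...   | no x∉  = _ , link e π , (¬Any⇒All¬ xs x∉ ∷ u) , (px ∷ ps)

  path-consecutive : ∀ {x z y ys} → Path x z (y ∷ ys) → (i : Fin (length ys)) →
                     Edge T' (lookup (y ∷ ys) (inject₁ i)) (lookup ys i)
  path-consecutive (link e stop)        zero    = e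
  path-consecutive (link e (link _ _))  zero    = e
  path-consecutive (link _ π@(link _ _)) (suc i) = path-consecutive π i

  path-last : ∀ {x z y ys} → Path x z (y ∷ ys) → lookup (y ∷ ys) (fromℕ (length ys)) ≡ z
  path-last stop                  = refl
  path-last (link _ stop)         = refl
  path-last (link _ π@(link _ _)) = path-last π

  -- `a ≢ b` gives the path at least two vertices, so with `p` in front there are at least three.
  closed-path : ∀ {p a b xs} → Edge T' p a → Path a b xs → Edge T' b p → a ≢ b →
                Unique xs → All (_≢ p) xs → Cycle T'
  closed-path {p} {b = b} {xs = xs} pa π bp a≢b u avoids = record
    { l      = length xs
    ; long   = long π a≢b
    ; c      = lookup (p ∷ xs)
    ; inj    = lookup-injective (All.map (_∘ sym) avoids ∷ u)
    ; consec = path-consecutive (link pa π)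
    ; close  = subst (λ y → Edge T' y p) (sym (path-last (link pa π))) bp
    }
    where
    long : ∀ {a b xs} → Path a b xs → a ≢ b → 2 ≤ length xs
    long stop                a≢b = contradiction refl a≢b
    long (link _ stop)       _   = s≤s (s≤s z≤n)
    long (link _ (link _ _)) _   = s≤s (s≤s z≤n)

  -- Acyclic graphs and orientations

  module Acyclic (acyclic : ¬ Cycle T') where

    branch-unique : ∀ {p a b k} → Edge T' p a → Edge T' p b → Walk T' (_≢ p) a b k → a ≡ b
    branch-unique {a = a} {b} pa pb w with a ≟ b
    ... | yes a≡b = a≡b
    ... | no a≢b  =
      let xs , π , u , avoids = erase-loops w
      in contradiction (closed-path pa π (edge-sym T' pb) a≢b u avoids) acyclic

    -- A walk from `p` to `r` leaves `p` for good at a neighbour `a` other than `q`. From `a` one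
    -- gets to `q` via `r` without meeting `p`, so `branch-unique` forces `a ≡ q`.
    sides-disjoint : ∀ {p q r j k} → Edge T' p q → Walk T' (_≢ q) p r j → ¬ Walk T' (_≢ p) q r k
    sides-disjoint pq w w′ =
      let a , _ , pa , w″ = leave (end w′) w
      in proj₁ (start w″) (branch-unique pa pq (weaken proj₂ w″ ⊕ reverse w′))

    private
      -- The period is `suc k`: it is positive, and `k` matches `l` in `Cycle`.
      Periodic : (Fin m → Fin m) → ℕ → Set
      Periodic d k = ∀ p → fold p d (suc k) ≡ p → ∃[ q ] d (d q) ≡ q

    module _ (d : Fin m → Fin m) (along : ∀ p → Edge T' p (d p)) where

      return : ∀ p {i j} → i < j → fold p d i ≡ fold p d j →
               fold (fold p d i) d (suc (j ∸ suc i)) ≡ fold p d i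
      return p {i} {j} i<j eq =
        trans (sym (fold-+ p d (suc (j ∸ suc i))))
              (trans (cong (fold p d) (trans (sym (+-suc (j ∸ suc i) i)) (m∸n+n≡m i<j))) (sym eq))

      orbit-cycle : ∀ p l → 2 ≤ l → fold p d (suc l) ≡ p →
                    Injective _≡_ _≡_ (λ (i : Fin (suc l)) → fold p d (toℕ i)) → Cycle T'
      orbit-cycle p l 2≤l eq inj = record
        { l      = l
        ; long   = 2≤l
        ; c      = λ i → fold p d (toℕ i)
        ; inj    = inj
        ; consec = λ i → subst (λ j → Edge T' (fold p d j) (d (fold p d (toℕ i)))) (sym (toℕ-inject₁ i)) (along _)
        ; close  = subst (λ j → Edge T' (fold p d j) p) (sym (toℕ-fromℕ l)) (subst (Edge T' _) eq (along _))
        }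

      -- By strong induction, a repetition inside a period yields a shorter one. A period without
      -- repetitions is not 1, as there are no loops, nor 3 or more, as there are no cycles; so it
      -- is 2.
      periodic : ∀ k → Periodic d k
      periodic = <-rec (Periodic d) shorten
        where
        shorten : ∀ k → (∀ {j} → j < k → Periodic d j) → Periodic d k
        shorten k rec p eq
          with any? (λ (i : Fin (suc k)) → any? (λ (j : Fin (suc k)) →
                 (toℕ i <? toℕ j) ×-dec (fold p d (toℕ i) ≟ fold p d (toℕ j))))
        ... | yes (i , j , i<j , eq′) = rec smaller (fold p d (toℕ i)) (return p i<j eq′)
          where
          smaller : toℕ j ∸ suc (toℕ i) < k
          smaller = ≤-trans (≤-reflexive (sym (+-∸-assoc 1 i<j))) (≤-trans (m∸n≤m (toℕ j) (toℕ i)) (≤-pred (toℕ<n j)))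
        ... | no distinct = by-length k eq inj
          where
          inj : Injective _≡_ _≡_ (λ (i : Fin (suc k)) → fold p d (toℕ i))
          inj {i} {j} e with <-cmp (toℕ i) (toℕ j)
          ... | tri< i<j _ _ = contradiction (i , j , i<j , e) distinct
          ... | tri≈ _ i≡j _ = toℕ-injective i≡j
          ... | tri> _ _ j<i = contradiction (j , i , j<i , sym e) distinct
          by-length : ∀ k → fold p d (suc k) ≡ p → Injective _≡_ _≡_ (λ (i : Fin (suc k)) → fold p d (toℕ i)) →
                      ∃[ q ] d (d q) ≡ q
          by-length zero          eq _   = contradiction (subst (Edge T' p) eq (along p)) (edge-irrefl T')
          by-length (suc zero)    eq _   = p , eq
          by-length (suc (suc k)) eq inj =
            contradiction (orbit-cycle p (suc (suc k)) (s≤s (s≤s z≤n)) eq inj) acyclic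

      -- Two of the first `m + 1` iterates of `d` agree, which gives a periodic point. With `d` read
      -- as an orientation, some edge is oriented both ways.
      backtrack : Fin m → ∃[ q ] d (d q) ≡ q
      backtrack p with pigeonhole (n<1+n m) (λ i → fold p d (toℕ i))
      ... | i , j , i<j , eq = periodic (toℕ j ∸ suc (toℕ i)) (fold p d (toℕ i)) (return p i<j eq)

-- Subsets and decidability of balls

∈-tabulate⁺ : ∀ {n} (f : Fin n → Bool) {i} → T (f i) → i ∈ tabulate f
∈-tabulate⁺ f {i} fi = lookup⇒[]= i (tabulate f) (trans (lookup∘tabulate f i) (Equivalence.to T-≡ fi))

∈-tabulate⁻ : ∀ {n} (f : Fin n → Bool) {i} → i ∈ tabulate f → T (f i)
∈-tabulate⁻ f {i} i∈ = Equivalence.from T-≡ (trans (sym (lookup∘tabulate f i)) ([]=⇒lookup i∈))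

⊆∧∣∣≥⇒⊇ : ∀ {n} {p q : Subset n} → p ⊆ q → ∣ q ∣ ≤ ∣ p ∣ → q ⊆ p
⊆∧∣∣≥⇒⊇ {p = p} p⊆q ∣q∣≤∣p∣ {x} x∈q with x ∈? p
... | yes x∈p = x∈p
... | no x∉p  = contradiction ∣q∣≤∣p∣ (<⇒≱ (p⊂q⇒∣p∣<∣q∣ (p⊆q , x , x∈q , x∉p)))

∣∣>0⇒nonempty : ∀ {n} (p : Subset n) → 1 ≤ ∣ p ∣ → Nonempty p
∣∣>0⇒nonempty {n} p 1≤∣p∣ with nonempty? p
... | yes ne = ne
... | no ¬ne = contradiction (≤-trans 1≤∣p∣ (≤-reflexive (trans (cong ∣_∣ (Empty-unique ¬ne)) (∣⊥∣≡0 n)))) λ()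

walk? : ∀ {n} (G : Graph n) {P : Fin n → Set} → (∀ x → Dec (P x)) → ∀ x z k → Dec (Walk G P x z k)
walk? G P? x z zero = map′ (λ { (refl , px) → here px }) (λ { (here px) → refl , px }) ((x ≟ z) ×-dec P? x)
walk? G P? x z (suc k) =
  map′ (λ (_ , px , e , w) → step px e w) (λ { (step px e w) → _ , px , e , w })
       (any? λ y → P? x ×-dec T? (adj G x y) ×-dec walk? G P? y z k)

-- Used both to show by contradiction that edges lie in a ball and to cut the bags of a star down to
-- a ball.
ball? : ∀ {n} (G : Graph n) S v r u → Dec (Ball G S v r u)
ball? G S v r u =
  map′ (λ (k , k<1+r , w) → k , ≤-pred k<1+r , w) (λ (k , k≤r , w) → k , s≤s k≤r , w)
       (anyUpTo? (walk? G (_∈? S) v u) (suc r))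

-- Edges and the vertices adjacent to neither end

module _ {n : ℕ} (G : Graph n) where

  nbrs : Fin n → Subset n
  nbrs x = tabulate (adj G x)

  nonNbrs : Fin n → Fin n → Subset n
  nonNbrs = commonNbrs (complementAdj G)

  -- Membership in a closed neighbourhood. Equality is included because no vertex is `complementAdj`
  -- to itself; thus `nonNbrs u v` is what neither end touches.
  Touches : Fin n → Fin n → Set
  Touches u w = u ≡ w ⊎ Edge G u w

  touches? : ∀ u w → Dec (Touches u w)
  touches? u w = (u ≟ w) ⊎-dec T? (adj G u w)

  co-edge : ∀ {u w} → ¬ Touches u w → T (complementAdj G u w)
  co-edge {u} {w} ¬t with adj G u w | u ≟ w
  ... | true  | _       = ⊥-elim (¬t (inj₂ tt))
  ... | false | yes u≡w = ⊥-elim (¬t (inj₁ u≡w))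
  ... | false | no _    = tt

  nonNbrs⁺ : ∀ {u v w} → ¬ Touches u w → ¬ Touches v w → w ∈ nonNbrs u v
  nonNbrs⁺ ¬uw ¬vw = ∈-tabulate⁺ _ (Equivalence.from T-∧ (co-edge ¬uw , co-edge ¬vw))

  nonNbrs-or-touches : ∀ u v w → w ∈ nonNbrs u v ⊎ (Touches u w ⊎ Touches v w)
  nonNbrs-or-touches u v w with touches? u w | touches? v w
  ... | yes uw | _      = inj₂ (inj₁ uw)
  ... | no _   | yes vw = inj₂ (inj₂ vw)
  ... | no ¬uw | no ¬vw = inj₁ (nonNbrs⁺ ¬uw ¬vw)

  record Split (s : ℕ) (S : Subset n) : Set where
    field
      A       : Subset n
      u v x y : Fin n
      ∣A∣≤s   : ∣ A ∣ ≤ s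
      A⊆S     : A ⊆ S
      uv      : Edge G u v
      xy      : Edge G x y
      rest    : ∀ {w} → w ∈ S → w ∉ A → w ∈ nonNbrs u v ⊎ w ∈ nonNbrs x y

  -- What a star needs: a bag `B` at the centre, and for any other `x` in `S` a leaf holding `x` and
  -- its neighbours in `B`.
  record Centred (s : ℕ) (S : Subset n) : Set where
    field
      B           : Subset n
      ∣B∣≤1+s     : ∣ B ∣ ≤ suc s
      B⊆S         : B ⊆ S
      independent : ∀ {u v} → u ∈ S → u ∉ B → v ∈ S → v ∉ B → ¬ Edge G u v
      fewNbrs     : ∀ {x} → x ∈ S → x ∉ B → ∣ nbrs x ∩ B ∣ ≤ s

  module _ (S : Subset n) where

    EdgeOutside : Subset n → Set
    EdgeOutside B = ∃[ u ] ∃[ v ] ((u ∈ S × u ∉ B) × (v ∈ S × v ∉ B) × Edge G u v)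

    edgeOutside? : ∀ B → Dec (EdgeOutside B)
    edgeOutside? B = any? λ u → any? λ v →
      ((u ∈? S) ×-dec ¬? (u ∈? B)) ×-dec ((v ∈? S) ×-dec ¬? (v ∈? B)) ×-dec T? (adj G u v)

    -- Any edge outside B would do, but it must depend on B only and not on
    -- the proof of existence: equal bags have to choose equal edges.
    chooseEdge : ∀ B → EdgeOutside B → EdgeOutside B
    chooseEdge B h with edgeOutside? B
    ... | yes e = e
    ... | no ¬e = contradiction h ¬e

    chooseEdge-irrelevant : ∀ {B B′} h h′ → B ≡ B′ → proj₁ (chooseEdge B h) ≡ proj₁ (chooseEdge B′ h′)
    chooseEdge-irrelevant {B} h h′ refl with edgeOutside? B
    ... | yes e = refl
    ... | no ¬e = contradiction h ¬e

  -- From a tree decomposition to `Split` or `Centred`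

  module Decomposed
    (S : Subset n) (s : ℕ) {W : Fin n → Set} (td : TreeDecomposition G W s)
    (W⊆S : ∀ {u} → W u → u ∈ S)
    (edge⇒W : ∀ {u v} → u ∈ S → v ∈ S → Edge G u v → W u)
    where

    open TreeDecomposition td
    open Acyclic {T' = tree} (proj₂ (proj₂ isTree))

    connected : Connected tree
    connected = proj₁ (proj₂ isTree)

    -- Vertices of `S` outside `W` are isolated in `G[S]`, so a neighbour `w` of `u` is in `W` as
    -- well and the decomposition covers the edge.
    bag-of-touching : ∀ {u w} → W u → w ∈ S → Touches u w → ∃[ r ] (u ∈ bag r × w ∈ bag r)
    bag-of-touching {u} Wu w∈S (inj₁ refl) = let r , u∈ = vertices u Wu in r , u∈ , u∈
    bag-of-touching {u} {w} Wu w∈S (inj₂ uw) =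
      edges u w Wu (edge⇒W w∈S (W⊆S Wu) (edge-sym G uw)) uw

    -- With `a` a neighbour of `p`, this is the branch at `p` that contains `a`; `Toward` confines
    -- the bags of `u` to it.
    Avoiding : Fin m → Fin m → Fin m → Set
    Avoiding p a q = ∃[ k ] Walk tree (_≢ p) a q k

    Toward : Fin m → Fin m → Fin n → Set
    Toward p a u = ∀ {q} → u ∈ bag q → Avoiding p a q

    -- The bags with `u` are connected in the tree and `p` is not among them, so one branch at `p`
    -- holds them all.
    travel : ∀ {p u q r a} → u ∉ bag p → u ∈ bag q → u ∈ bag r → Avoiding p a q → Avoiding p a r
    travel {p} {u} u∉p u∈q u∈r (_ , w) =
      let _ , w′ = coherent u _ _ u∈q u∈r
      in _ , w ⊕ weaken (λ { u∈z refl → u∉p u∈z }) w′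

    opposite : ∀ {p a q} → Edge tree p a → Avoiding a p q → ¬ Avoiding p a q
    opposite pa (_ , w) (_ , w′) = sides-disjoint pa w w′

    toward : ∀ {p u q} → u ∉ bag p → u ∈ bag q → ∃[ a ] (Edge tree p a × Avoiding p a q)
    toward {p} {u} {q} u∉p u∈q =
      let a , j , pa , w = leave (λ { refl → u∉p u∈q }) (proj₂ (connected p q))
      in a , pa , j , weaken proj₂ w

    -- An intersection of `s + 1` vertices exhausts both bags. The bound `s` instead of `s + 1`
    -- saves a factor `n` in the count.
    ∣bag∩bag∣≤s⊎≡ : ∀ p p′ → ∣ bag p ∩ bag p′ ∣ ≤ s ⊎ bag p ≡ bag p′
    ∣bag∩bag∣≤s⊎≡ p p′ with ∣ bag p ∩ bag p′ ∣ ≤? s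
    ... | yes ≤s = inj₁ ≤s
    ... | no ≰s  = inj₂ (⊆-antisym
      (λ x∈ → p∩q⊆q (bag p) (bag p′) (⊆∧∣∣≥⇒⊇ (p∩q⊆p (bag p) (bag p′)) (≤-trans (small p) (≰⇒> ≰s)) x∈))
      (λ x∈ → p∩q⊆p (bag p) (bag p′) (⊆∧∣∣≥⇒⊇ (p∩q⊆q (bag p) (bag p′)) (≤-trans (small p′) (≰⇒> ≰s)) x∈)))

    -- The reason for orienting `p` towards `a`: an edge whose ends occur only in bags on that side.
    record Beyond (p a : Fin m) : Set where
      field
        {u v}    : Fin n
        uv       : Edge G u v
        Wu       : W u
        Wv       : W v
        toward-u : Toward p a u
        toward-v : Toward p a v

    beyond : ∀ p → (e : EdgeOutside S (bag p)) →
             ∃[ a ] (Edge tree p a × Σ (Beyond p a) λ b → Beyond.u b ≡ proj₁ e)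
    beyond p (u , v , (u∈S , u∉p) , (v∈S , v∉p) , uv) =
      let Wu            = edge⇒W u∈S v∈S uv
          Wv            = edge⇒W v∈S u∈S (edge-sym G uv)
          -- The bag of `q` holds both ends, so the branch found for `u` serves `v` too.
          q , u∈q , v∈q = edges u v Wu Wv uv
          a , pa , w    = toward u∉p u∈q
      in a , pa , record
           { uv       = uv
           ; Wu       = Wu
           ; Wv       = Wv
           ; toward-u = λ u∈r → travel u∉p u∈q u∈r w
           ; toward-v = λ v∈r → travel v∉p v∈q v∈r w
           } , refl

    -- A vertex that touches `u` or `v` shares a bag with it, and that bag lies in the branch of
    -- `a`.
    reaches : ∀ {p a} (b : Beyond p a) {w} → w ∈ S →
              w ∈ nonNbrs (Beyond.u b) (Beyond.v b) ⊎ (∃[ r ] (w ∈ bag r × Avoiding p a r))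
    reaches b {w} w∈S with nonNbrs-or-touches (Beyond.u b) (Beyond.v b) w
    ... | inj₁ w∈        = inj₁ w∈
    ... | inj₂ (inj₁ uw) = let r , u∈r , w∈r = bag-of-touching (Beyond.Wu b) w∈S uw
                           in inj₂ (r , w∈r , Beyond.toward-u b u∈r)
    ... | inj₂ (inj₂ vw) = let r , v∈r , w∈r = bag-of-touching (Beyond.Wv b) w∈S vw
                           in inj₂ (r , w∈r , Beyond.toward-v b v∈r)

    split : ∀ {p p′} → Edge tree p p′ → (b : Beyond p p′) (b′ : Beyond p′ p) →
            (bag p ≡ bag p′ → Beyond.u b ≡ Beyond.u b′) → Split s S
    split {p} {p′} pp′ b b′ same = record
      { A     = bag p ∩ bag p′
      ; ∣A∣≤s = [ id , (λ eq → contradiction eq distinct) ]′ (∣bag∩bag∣≤s⊎≡ p p′)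
      ; A⊆S   = λ w∈A → W⊆S (bag⊆W p _ (p∩q⊆p (bag p) (bag p′) w∈A))
      ; uv    = Beyond.uv b
      ; xy    = Beyond.uv b′
      ; rest  = rest
      }
      where
      -- With equal bags the two edges would have the same first end, whose bags would lie on both
      -- sides of the tree edge.
      distinct : bag p ≢ bag p′
      distinct eq =
        let q , u∈q = vertices _ (Beyond.Wu b)
        in opposite pp′ (Beyond.toward-u b′ (subst (_∈ bag q) (same eq) u∈q)) (Beyond.toward-u b u∈q)

      rest : ∀ {w} → w ∈ S → w ∉ bag p ∩ bag p′ →
             w ∈ nonNbrs (Beyond.u b) (Beyond.v b) ⊎ w ∈ nonNbrs (Beyond.u b′) (Beyond.v b′)
      rest {w} w∈S w∉A with reaches b w∈S | reaches b′ w∈S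
      ... | inj₁ w∈ | _       = inj₁ w∈
      ... | inj₂ _  | inj₁ w∈ = inj₂ w∈
      -- Now `w` has a bag on each side of the tree edge, so coherence puts it into both end bags,
      -- that is, into `A`.
      ... | inj₂ (r , w∈r , to-r) | inj₂ (r′ , w∈r′ , to-r′) with w ∈? bag p
      ...   | no w∉p  = contradiction (travel w∉p w∈r w∈r′ to-r) (opposite pp′ to-r′)
      ...   | yes w∈p = contradiction to-r
        (opposite pp′ (travel (λ w∈p′ → w∉A (x∈p∩q⁺ (w∈p , w∈p′))) w∈r′ w∈r to-r′))

    split-along : (next : Fin m → Fin m) (target : Fin m → Fin n) →
                  (∀ p → Edge tree p (next p) × Σ (Beyond p (next p)) λ b → Beyond.u b ≡ target p) →
                  (∀ p p′ → bag p ≡ bag p′ → target p ≡ target p′) → Fin m → Split s S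
    split-along next target choice target-cong p₀ =
      let q , back     = backtrack next (λ p → proj₁ (choice p)) p₀
          pp′ , b , u≡ = choice q
          -- `next` leads from `next q` back to `q`, so the witness at `next q` faces the one at
          -- `q`.
          b′ , u′≡     = subst (λ a → Σ (Beyond (next q) a) λ b → Beyond.u b ≡ target (next q))
                               back (proj₂ (choice (next q)))
      in split pp′ b b′ (λ eq → trans u≡ (trans (target-cong q (next q) eq) (sym u′≡)))

    split-if-edges-outside : (∀ p → EdgeOutside S (bag p)) → Fin m → Split s S
    split-if-edges-outside h =
      split-along (λ p → proj₁ (choice p)) (λ p → proj₁ (chooseEdge S (bag p) (h p)))
                  (λ p → proj₂ (choice p)) (λ p p′ → chooseEdge-irrelevant S (h p) (h p′))
      where
      choice : ∀ p → ∃[ a ] (Edge tree p a × Σ (Beyond p a) λ b → Beyond.u b ≡ proj₁ (chooseEdge S (bag p) (h p)))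
      choice p = beyond p (chooseEdge S (bag p) (h p))

    module _ {B : Subset n} {x : Fin n} {q : Fin m} (1+s≤∣B∣ : suc s ≤ ∣ B ∣) (Wx : W x) (x∉B : x ∉ B)
             (B⊆S : B ⊆ S) (adjacent : ∀ {b} → b ∈ B → Edge G x b) (x∈q : x ∈ bag q) where

      too-large : ∀ p → B ⊆ bag p → x ∉ bag p
      too-large p B⊆p x∈p =
        <-irrefl refl (≤-trans (p⊂q⇒∣p∣<∣q∣ (B⊆p , x , x∈p , x∉B)) (≤-trans (small p) 1+s≤∣B∣))

      -- By acyclicity the bag next to p on the way to x still contains B, and
      -- B ∪ {x} does not fit into a bag; so the path never reaches x.
      climb : ∀ {p xs} → Path {T' = tree} p q xs → Unique xs → ¬ (B ⊆ bag p)
      climb stop _ B⊆q = too-large q B⊆q x∈q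
      climb {p} (link {y = a} pa π) (p∉ ∷ uniq) B⊆p = climb π uniq λ {b} b∈B →
        let x∉p = too-large p B⊆p
            r , x∈r , b∈r    = bag-of-touching Wx (B⊆S b∈B) (inj₂ (adjacent b∈B))
            _ , w            = travel x∉p x∈q x∈r (path-walk π (All.map (_∘ sym) p∉))
            a′ , _ , pa′ , w′ = leave (λ { refl → x∉p x∈r }) (proj₂ (coherent b p r (B⊆p b∈B) b∈r))
            a≡a′ = branch-unique pa pa′ (w ⊕ reverse (weaken proj₂ w′))
        in subst (λ z → b ∈ bag z) (sym a≡a′) (proj₁ (start w′))

    -- With more than `s` neighbours in a bag of at most `s + 1` vertices, `x` is adjacent to the
    -- whole bag, which is full. A path from `p` to a bag with `x` then contradicts `climb`.
    fewNbrs-in-bag : ∀ p {x} → x ∈ S → x ∉ bag p → ∣ nbrs x ∩ bag p ∣ ≤ s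
    fewNbrs-in-bag p {x} x∈S x∉p with ∣ nbrs x ∩ bag p ∣ ≤? s
    ... | yes ≤s = ≤s
    ... | no ≰s  =
      let B⊆nbrs : bag p ⊆ nbrs x ∩ bag p
          B⊆nbrs = ⊆∧∣∣≥⇒⊇ (p∩q⊆q (nbrs x) (bag p)) (≤-trans (small p) (≰⇒> ≰s))
          adjacent : ∀ {b} → b ∈ bag p → Edge G x b
          adjacent b∈ = ∈-tabulate⁻ (adj G x) (p∩q⊆p (nbrs x) (bag p) (B⊆nbrs b∈))
          B⊆S : bag p ⊆ S
          B⊆S b∈ = W⊆S (bag⊆W p _ b∈)
          1+s≤ = ≤-trans (≰⇒> ≰s) (∣p∩q∣≤∣q∣ (nbrs x) (bag p))
          -- A neighbour of `x` in the bag is needed to place `x` in `W`, hence in some bag.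
          b , b∈ = ∣∣>0⇒nonempty (bag p) (≤-trans (s≤s z≤n) 1+s≤)
          Wx = edge⇒W x∈S (B⊆S b∈) (adjacent b∈)
          q , x∈q = vertices x Wx
          _ , π , uniq , _ = erase-loops (proj₂ (connected p q))
      in ⊥-elim (climb 1+s≤ Wx x∉p B⊆S adjacent x∈q π uniq id)

    split-or-centred : Split s S ⊎ Centred s S
    split-or-centred with any? (λ p → ¬? (edgeOutside? S (bag p)))
    ... | yes (p , none) = inj₂ record
      { B           = bag p
      ; ∣B∣≤1+s     = small p
      ; B⊆S         = λ u∈ → W⊆S (bag⊆W p _ u∈)
      ; independent = λ u∈S u∉p v∈S v∉p uv → none (_ , _ , (u∈S , u∉p) , (v∈S , v∉p) , uv)
      ; fewNbrs     = fewNbrs-in-bag p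
      }
    ... | no all-have = inj₁ (split-if-edges-outside
      (λ p → decidable-stable (edgeOutside? S (bag p)) (λ none → all-have (p , none)))
      (some-node (proj₁ isTree)))
      where
      some-node : ∀ {m} → 1 ≤ m → Fin m
      some-node (s≤s _) = zero

  -- Balls of radius four

  module _ {S : Subset n} where

    touches-walk : ∀ {u v w} → u ∈ S → v ∈ S → w ∈ S → Edge G u v → Touches u w ⊎ Touches v w →
                   ∃[ k ] (k ≤ 2 × Walk G (_∈ S) u w k)
    touches-walk u∈ v∈ w∈ uv (inj₁ (inj₁ refl)) = 0 , z≤n , here u∈
    touches-walk u∈ v∈ w∈ uv (inj₁ (inj₂ uw))   = 1 , s≤s z≤n , step u∈ uw (here w∈)
    touches-walk u∈ v∈ w∈ uv (inj₂ (inj₁ refl)) = 1 , s≤s z≤n , step u∈ uv (here v∈)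
    touches-walk u∈ v∈ w∈ uv (inj₂ (inj₂ vw))   = 2 , ≤-refl , step u∈ uv (step v∈ vw (here w∈))

  locally-bounded⇒split-or-centred : ∀ {r s} S → 4 ≤ r → LtwAtMost G S r s → Split s S ⊎ Centred s S
  locally-bounded⇒split-or-centred {r} {s} S 4≤r ltw with edgeOutside? S ⊥
  -- No edge avoids the empty set, so `S` is independent and an empty centre will do.
  ... | no none = inj₂ record
    { B           = ⊥
    ; ∣B∣≤1+s     = ≤-trans (≤-reflexive (∣⊥∣≡0 n)) z≤n
    ; B⊆S         = λ u∈ → contradiction u∈ ∉⊥
    ; independent = λ u∈ u∉ v∈ v∉ uv → none (_ , _ , (u∈ , u∉) , (v∈ , v∉) , uv)
    ; fewNbrs     = λ {x} _ _ → ≤-trans (∣p∩q∣≤∣q∣ (nbrs x) ⊥) (≤-trans (≤-reflexive (∣⊥∣≡0 n)) z≤n)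
    }
  ... | yes (u , v , (u∈ , _) , (v∈ , _) , uv)
    with any? (λ x → any? (λ y → (x ∈? S) ×-dec (y ∈? S) ×-dec T? (adj G x y) ×-dec
           all? (λ w → (w ∈? S) →-dec ((w ∈? nonNbrs u v) ⊎-dec (w ∈? nonNbrs x y)))))
  ...   | yes (x , y , _ , _ , xy , covered) = inj₁ record
    { A     = ⊥
    ; ∣A∣≤s = ≤-trans (≤-reflexive (∣⊥∣≡0 n)) z≤n
    ; A⊆S   = λ u∈ → contradiction u∈ ∉⊥
    ; uv    = uv
    ; xy    = xy
    ; rest  = λ w∈ _ → covered _ w∈
    }
  ...   | no uncovered = Decomposed.split-or-centred S s (ltw u u∈) (λ (_ , _ , w) → end w) edge⇒ball
    where
    edge⇒ball : ∀ {x y} → x ∈ S → y ∈ S → Edge G x y → Ball G S u r x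
    -- If `x` were outside the ball, `uv` and `xy` would cover `S` with their non-neighbours, which
    -- has been excluded.
    edge⇒ball {x} {y} x∈ y∈ xy = decidable-stable (ball? G S u r x) λ ∉ball →
      uncovered (x , y , x∈ , y∈ , xy , λ w w∈ → near w w∈ ∉ball)
      where
      near : ∀ w → w ∈ S → ¬ Ball G S u r x → w ∈ nonNbrs u v ⊎ w ∈ nonNbrs x y
      near w w∈ ∉ball with nonNbrs-or-touches u v w | nonNbrs-or-touches x y w
      ... | inj₁ far | _        = inj₁ far
      ... | inj₂ _   | inj₁ far = inj₂ far
      -- `w` is within two steps of `u` and of `x`, hence the radius 2 + 2.
      ... | inj₂ uw  | inj₂ xw  =
        let j , j≤2 , w₁ = touches-walk u∈ v∈ w∈ uv uw
            k , k≤2 , w₂ = touches-walk x∈ y∈ w∈ xy xw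
        in contradiction (j + k , ≤-trans (+-mono-≤ j≤2 k≤2) 4≤r , w₁ ⊕ reverse w₂) ∉ball

∣p∪q∣≤∣p∣+∣q∣ : ∀ {n} (p q : Subset n) → ∣ p ∪ q ∣ ≤ ∣ p ∣ + ∣ q ∣
∣p∪q∣≤∣p∣+∣q∣ []            []            = z≤n
∣p∪q∣≤∣p∣+∣q∣ (outside ∷ p) (outside ∷ q) = ∣p∪q∣≤∣p∣+∣q∣ p q
∣p∪q∣≤∣p∣+∣q∣ (outside ∷ p) (inside ∷ q)  =
  ≤-trans (s≤s (∣p∪q∣≤∣p∣+∣q∣ p q)) (≤-reflexive (sym (+-suc ∣ p ∣ ∣ q ∣)))
∣p∪q∣≤∣p∣+∣q∣ (inside ∷ p)  (outside ∷ q) = s≤s (∣p∪q∣≤∣p∣+∣q∣ p q)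
∣p∪q∣≤∣p∣+∣q∣ (inside ∷ p)  (inside ∷ q)  =
  s≤s (≤-trans (∣p∪q∣≤∣p∣+∣q∣ p q) (+-monoʳ-≤ ∣ p ∣ (n≤1+n ∣ q ∣)))

-- Star decompositions

star : ∀ n → Graph (suc n)
star n = record { adj = starAdj ; sym = starSym ; irrefl = starIrrefl }
  where
  starAdj : Fin (suc n) → Fin (suc n) → Bool
  starAdj zero    zero    = false
  starAdj zero    (suc _) = true
  starAdj (suc _) zero    = true
  starAdj (suc _) (suc _) = false

  starSym : ∀ u v → starAdj u v ≡ starAdj v u
  starSym zero    zero    = refl
  starSym zero    (suc _) = refl
  starSym (suc _) zero    = refl
  starSym (suc _) (suc _) = refl

  starIrrefl : ∀ u → starAdj u u ≡ false
  starIrrefl zero    = refl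
  starIrrefl (suc _) = refl

star-through-centre : ∀ {n} {P : Fin (suc n) → Set} x y → P x → P zero → P y → ∃[ k ] Walk (star n) P x y k
star-through-centre zero    zero    _  p0 _  = _ , here p0
star-through-centre zero    (suc _) _  p0 py = _ , step p0 tt (here py)
star-through-centre (suc _) zero    px p0 _  = _ , step px tt (here p0)
star-through-centre (suc _) (suc _) px p0 py = _ , step px tt (step p0 tt (here py))

-- Every edge of a star has exactly one end at the centre, so the centre sits at every other vertex
-- of a walk.
star-path-revisits-centre : ∀ {n} w x y z → Edge (star n) w x → Edge (star n) x y → Edge (star n) y z →
                            w ≡ y ⊎ x ≡ z
star-path-revisits-centre zero    (suc _) zero    _       _ _ _ = inj₁ refl
star-path-revisits-centre (suc _) zero    (suc _) zero    _ _ _ = inj₂ refl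

star-acyclic : ∀ {n} → ¬ Cycle (star n)
star-acyclic record { l = suc (suc l) ; c = c ; inj = inj ; consec = consec ; close = close }
  -- The last vertex of the cycle is followed by its first three. In a triangle the last is also the
  -- third, yet both equations compare different positions.
  with star-path-revisits-centre (c (fromℕ (suc (suc l)))) (c zero) (c (suc zero)) (c (suc (suc zero)))
         close (consec zero) (consec (suc zero))
... | inj₁ eq = contradiction (inj eq) λ()
... | inj₂ eq = contradiction (inj eq) λ()
star-acyclic record { l = zero ; long = () }
star-acyclic record { l = suc zero ; long = s≤s () }

star-isTree : ∀ n → IsTree (star n)
star-isTree n = s≤s z≤n , (λ x y → star-through-centre x y tt tt tt) , star-acyclic

widen : ∀ {n} {G : Graph n} {W k k′} → k ≤ k′ → TreeDecomposition G W k → TreeDecomposition G W k′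
widen k≤k′ td = record
  { TreeDecomposition td
  ; small = λ x → ≤-trans (TreeDecomposition.small td x) (s≤s k≤k′)
  }

module _ {n : ℕ} (G : Graph n) where

  module _ {s : ℕ} {S : Subset n} (centred : Centred G s S)
           {W : Fin n → Set} (W? : ∀ u → Dec (W u)) (W⊆S : ∀ {u} → W u → u ∈ S) where

    open Centred centred

    private
      Wₛ : Subset n
      Wₛ = tabulate (λ u → ⌊ W? u ⌋)

      ∈Wₛ⁺ : ∀ {u} → W u → u ∈ Wₛ
      ∈Wₛ⁺ {u} Wu = ∈-tabulate⁺ _ (fromWitness {a? = W? u} Wu)

      ∈Wₛ⁻ : ∀ {u} → u ∈ Wₛ → W u
      ∈Wₛ⁻ {u} u∈ = toWitness {a? = W? u} (∈-tabulate⁻ (λ u → ⌊ W? u ⌋) u∈)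

      -- Leaves are indexed by all vertices, with an empty bag for those not in `S ∖ B`, so that the
      -- tree depends on `n` only.
      leaf : ∀ i → Dec (i ∈ S × i ∉ B) → Subset n
      leaf i (yes _) = (⁅ i ⁆ ∪ (nbrs G i ∩ B)) ∩ Wₛ
      leaf i (no _)  = ⊥

      outside? : ∀ i → Dec (i ∈ S × i ∉ B)
      outside? i = (i ∈? S) ×-dec ¬? (i ∈? B)

      starBag : Fin (suc n) → Subset n
      starBag zero    = B ∩ Wₛ
      starBag (suc i) = leaf i (outside? i)

      starBag⁺ : ∀ i {u} → i ∈ S → i ∉ B → u ≡ i ⊎ (Edge G i u × u ∈ B) → W u → u ∈ starBag (suc i)
      starBag⁺ i i∈S i∉B u~i Wu with outside? i
      ... | no ¬out = contradiction (i∈S , i∉B) ¬out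
      ... | yes _   = x∈p∩q⁺ (x∈p∪q⁺ (in-leaf u~i) , ∈Wₛ⁺ Wu)
        where
        in-leaf : ∀ {u} → u ≡ i ⊎ (Edge G i u × u ∈ B) → u ∈ ⁅ i ⁆ ⊎ u ∈ nbrs G i ∩ B
        in-leaf (inj₁ refl)       = inj₁ (x∈⁅x⁆ i)
        in-leaf (inj₂ (iu , u∈B)) = inj₂ (x∈p∩q⁺ (∈-tabulate⁺ _ iu , u∈B))

      starBag⁻ : ∀ i {u} → u ∈ starBag (suc i) → W u × i ∉ B × (u ≡ i ⊎ u ∈ B)
      starBag⁻ i u∈ with outside? i
      ... | no _          = contradiction u∈ ∉⊥
      ... | yes (_ , i∉B) with x∈p∩q⁻ _ Wₛ u∈
      ...   | u∈leaf , u∈W with x∈p∪q⁻ ⁅ i ⁆ _ u∈leaf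
      ...     | inj₁ u∈i = ∈Wₛ⁻ u∈W , i∉B , inj₁ (x∈⁅y⁆⇒x≡y i u∈i)
      ...     | inj₂ u∈N = ∈Wₛ⁻ u∈W , i∉B , inj₂ (p∩q⊆q _ B u∈N)

      starBag⊆W : ∀ x u → u ∈ starBag x → W u
      starBag⊆W zero    u u∈ = ∈Wₛ⁻ (p∩q⊆q B Wₛ u∈)
      starBag⊆W (suc i) u u∈ = proj₁ (starBag⁻ i u∈)

      starBag-small : ∀ x → ∣ starBag x ∣ ≤ suc s
      starBag-small zero = ≤-trans (∣p∩q∣≤∣p∣ B Wₛ) ∣B∣≤1+s
      starBag-small (suc i) with outside? i
      ... | no _            = ≤-trans (≤-reflexive (∣⊥∣≡0 n)) z≤n
      ... | yes (i∈S , i∉B) = begin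
        ∣ (⁅ i ⁆ ∪ (nbrs G i ∩ B)) ∩ Wₛ ∣ ≤⟨ ∣p∩q∣≤∣p∣ (⁅ i ⁆ ∪ (nbrs G i ∩ B)) Wₛ ⟩
        ∣ ⁅ i ⁆ ∪ (nbrs G i ∩ B) ∣        ≤⟨ ∣p∪q∣≤∣p∣+∣q∣ ⁅ i ⁆ _ ⟩
        ∣ ⁅ i ⁆ ∣ + ∣ nbrs G i ∩ B ∣      ≤⟨ +-mono-≤ (≤-reflexive (∣⁅x⁆∣≡1 i)) (fewNbrs i∈S i∉B) ⟩
        suc s                             ∎
        where open ≤-Reasoning

      starVertices : ∀ u → W u → ∃[ x ] u ∈ starBag x
      starVertices u Wu with u ∈? B
      ... | yes u∈B = zero , x∈p∩q⁺ (u∈B , ∈Wₛ⁺ Wu)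
      ... | no u∉B  = suc u , starBag⁺ u (W⊆S Wu) u∉B (inj₁ refl) Wu

      starEdges : ∀ u v → W u → W v → Edge G u v → ∃[ x ] (u ∈ starBag x × v ∈ starBag x)
      starEdges u v Wu Wv uv with u ∈? B | v ∈? B
      ... | yes u∈B | yes v∈B = zero , x∈p∩q⁺ (u∈B , ∈Wₛ⁺ Wu) , x∈p∩q⁺ (v∈B , ∈Wₛ⁺ Wv)
      ... | yes u∈B | no v∉B  = suc v , starBag⁺ v (W⊆S Wv) v∉B (inj₂ (edge-sym G uv , u∈B)) Wu
                                      , starBag⁺ v (W⊆S Wv) v∉B (inj₁ refl) Wv
      ... | no u∉B  | yes v∈B = suc u , starBag⁺ u (W⊆S Wu) u∉B (inj₁ refl) Wu
                                      , starBag⁺ u (W⊆S Wu) u∉B (inj₂ (uv , v∈B)) Wv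
      ... | no u∉B  | no v∉B  = contradiction uv (independent (W⊆S Wu) u∉B (W⊆S Wv) v∉B)

      starBag-outside : ∀ x u → u ∉ B → u ∈ starBag x → x ≡ suc u
      starBag-outside zero    u u∉B u∈ = contradiction (p∩q⊆p B Wₛ u∈) u∉B
      starBag-outside (suc i) u u∉B u∈ with proj₂ (proj₂ (starBag⁻ i u∈))
      ... | inj₁ refl = refl
      ... | inj₂ u∈B  = contradiction u∈B u∉B

      -- A vertex of `B` found in any bag is also in the central one; any other vertex is only in
      -- its own leaf.
      starCoherent : ∀ u x y → u ∈ starBag x → u ∈ starBag y →
                     ∃[ j ] Walk (star n) (λ z → u ∈ starBag z) x y j
      starCoherent u x y u∈x u∈y with u ∈? B
      ... | yes u∈B = star-through-centre x y u∈x (x∈p∩q⁺ (u∈B , ∈Wₛ⁺ (starBag⊆W x u u∈x))) u∈y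
      ... | no u∉B with starBag-outside x u u∉B u∈x | starBag-outside y u u∉B u∈y
      ...   | refl | refl = zero , here u∈x

    starDecomposition : TreeDecomposition G W s
    starDecomposition = record
      { m        = suc n
      ; tree     = star n
      ; isTree   = star-isTree n
      ; bag      = starBag
      ; bag⊆W    = starBag⊆W
      ; small    = starBag-small
      ; vertices = starVertices
      ; edges    = starEdges
      ; coherent = starCoherent
      }

  -- Centred sets belong to the class

  singleton-centred : ∀ s v → Centred G s ⁅ v ⁆
  singleton-centred s v = record
    { B           = ⊥
    ; ∣B∣≤1+s     = ≤-trans (≤-reflexive (∣⊥∣≡0 n)) z≤n
    ; B⊆S         = λ u∈ → contradiction u∈ ∉⊥
    ; independent = λ x∈ _ y∈ _ xy → edge-irrefl G
        (subst₂ (λ x y → Edge G x y) (x∈⁅y⁆⇒x≡y v x∈) (x∈⁅y⁆⇒x≡y v y∈) xy)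
    ; fewNbrs     = λ {x} _ _ → ≤-trans (∣p∩q∣≤∣q∣ (nbrs G x) ⊥) (≤-trans (≤-reflexive (∣⊥∣≡0 n)) z≤n)
    }

  centred⇒InClass : ∀ {f s S} → (∀ r → 1 ≤ r → s ≤ f r) → Centred G s S → InClass f G S
  centred⇒InClass {f} {S = S} s≤f centred zero v v∈S =
    -- The hypothesis says nothing about `f 0`, but a ball of radius zero is a single vertex and any
    -- width suffices.
    starDecomposition (singleton-centred (f 0) v) (ball? G S v 0)
      λ { (zero , _ , here _) → x∈⁅x⁆ v }
  centred⇒InClass {S = S} s≤f centred (suc r) v v∈S =
    widen (s≤f (suc r) (s≤s z≤n))
      (starDecomposition centred (ball? G S v (suc r)) (λ (_ , _ , w) → end w))

  -- Used against maximality: keeping `B` fixed, only the conditions that involve `z` have to be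
  -- checked anew.
  centred-extend : ∀ {s S} (centred : Centred G s S) {z} →
                   z ∉ Centred.B centred → ∣ nbrs G z ∩ Centred.B centred ∣ ≤ s →
                   (∀ {y} → y ∈ S → y ∉ Centred.B centred → ¬ Edge G z y) → Centred G s (S ∪ ⁅ z ⁆)
  centred-extend {s} {S} centred {z} z∉B few free = record
    { B           = B
    ; ∣B∣≤1+s     = ∣B∣≤1+s
    ; B⊆S         = λ u∈ → p⊆p∪q ⁅ z ⁆ (B⊆S u∈)
    ; independent = λ u∈ u∉B v∈ v∉B → independent′ (old-or-new u∈) u∉B (old-or-new v∈) v∉B
    ; fewNbrs     = λ x∈ x∉B → fewNbrs′ (old-or-new x∈) x∉B
    }
    where
    open Centred centred

    old-or-new : ∀ {u} → u ∈ S ∪ ⁅ z ⁆ → u ∈ S ⊎ u ≡ z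
    old-or-new u∈ with x∈p∪q⁻ S ⁅ z ⁆ u∈
    ... | inj₁ u∈S = inj₁ u∈S
    ... | inj₂ u∈z = inj₂ (x∈⁅y⁆⇒x≡y z u∈z)

    independent′ : ∀ {u v} → u ∈ S ⊎ u ≡ z → u ∉ B → v ∈ S ⊎ v ≡ z → v ∉ B → ¬ Edge G u v
    independent′ (inj₁ u∈)   u∉B (inj₁ v∈)   v∉B = independent u∈ u∉B v∈ v∉B
    independent′ (inj₁ u∈)   u∉B (inj₂ refl) _   = free u∈ u∉B ∘ edge-sym G
    independent′ (inj₂ refl) _   (inj₁ v∈)   v∉B = free v∈ v∉B
    independent′ (inj₂ refl) _   (inj₂ refl) _   = edge-irrefl G

    fewNbrs′ : ∀ {x} → x ∈ S ⊎ x ≡ z → x ∉ B → ∣ nbrs G x ∩ B ∣ ≤ s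
    fewNbrs′ (inj₁ x∈)   x∉B = fewNbrs x∈ x∉B
    fewNbrs′ (inj₂ refl) _   = few

-- Enumerations of subsets

∈-concatMap : ∀ {A B : Set} {f : A → List B} {x y xs} → x ∈ₗ xs → y ∈ₗ f x → y ∈ₗ concatMap f xs
∈-concatMap {f = f} x∈ y∈ = ∈-concatMap⁺ f (lose x∈ y∈)

length-concatMap≤ : ∀ {A B : Set} {f : A → List B} {b} → (∀ x → length (f x) ≤ b) →
                    ∀ xs → length (concatMap f xs) ≤ length xs * b
length-concatMap≤ f≤b []               = z≤n
length-concatMap≤ {f = f} {b} f≤b (x ∷ xs) = begin
  length (f x ++ concatMap f xs)          ≡⟨ length-++ (f x) ⟩
  length (f x) + length (concatMap f xs)  ≤⟨ +-mono-≤ (f≤b x) (length-concatMap≤ f≤b xs) ⟩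
  b + length xs * b                       ∎
  where open ≤-Reasoning

unique-⊆⇒length≤ : ∀ {A : Set} {xs ys : List A} → Unique xs → (∀ {x} → x ∈ₗ xs → x ∈ₗ ys) →
                   length xs ≤ length ys
unique-⊆⇒length≤ {xs = xs} {ys} uniq xs⊆ys = injective⇒≤ {f = position} λ {i} {j} eq →
  lookup-injective uniq (trans (lookup-index (xs⊆ys (∈-lookup i)))
    (trans (cong (lookup ys) eq) (sym (lookup-index (xs⊆ys (∈-lookup j))))))
  where
  position : Fin (length xs) → Fin (length ys)
  position i = index (xs⊆ys (∈-lookup {xs = xs} i))

subsets : ∀ {n} → Subset n → List (Subset n)
subsets []            = [] ∷ []
subsets (outside ∷ p) = map (outside ∷_) (subsets p)
subsets (inside ∷ p)  = map (outside ∷_) (subsets p) ++ map (inside ∷_) (subsets p)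

length-subsets : ∀ {n} (p : Subset n) → length (subsets p) ≡ 2 ^ ∣ p ∣
length-subsets []            = refl
length-subsets (outside ∷ p) = trans (length-map _ (subsets p)) (length-subsets p)
length-subsets (inside ∷ p)  = begin
  length (map (outside ∷_) (subsets p) ++ map (inside ∷_) (subsets p))
    ≡⟨ length-++ (map (outside ∷_) (subsets p)) ⟩
  length (map (outside ∷_) (subsets p)) + length (map (inside ∷_) (subsets p))
    ≡⟨ cong₂ _+_ (trans (length-map _ (subsets p)) (length-subsets p))
                 (trans (length-map _ (subsets p)) (trans (length-subsets p) (sym (+-identityʳ _)))) ⟩
  2 ^ suc ∣ p ∣ ∎
  where open ≡-Reasoning

∈-subsets : ∀ {n} {p q : Subset n} → q ⊆ p → q ∈ₗ subsets p
∈-subsets {p = []}          {[]}          _   = here refl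
∈-subsets {p = outside ∷ p} {outside ∷ q} q⊆p = ∈-map⁺ _ (∈-subsets (drop-∷-⊆ q⊆p))
∈-subsets {p = outside ∷ p} {inside ∷ q}  q⊆p with q⊆p here
... | ()
∈-subsets {p = inside ∷ p}  {outside ∷ q} q⊆p = ∈-++⁺ˡ (∈-map⁺ _ (∈-subsets (drop-∷-⊆ q⊆p)))
∈-subsets {p = inside ∷ p}  {inside ∷ q}  q⊆p =
  ∈-++⁺ʳ (map (outside ∷_) (subsets p)) (∈-map⁺ _ (∈-subsets (drop-∷-⊆ q⊆p)))

-- Repetitions are harmless, as only the length is bounded. Each round inserts one of `n` vertices
-- or none, a factor `n + 1`.
smallSubsets : ∀ {n} → ℕ → List (Subset n)
smallSubsets         zero    = ⊥ ∷ []
smallSubsets {n} (suc k) = smallSubsets k ++ concatMap (λ v → map (⁅ v ⁆ ∪_) (smallSubsets k)) (allFin n)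

length-allFin : ∀ n → length (allFin n) ≡ n
length-allFin n = length-tabulate id

length-concatMap-allFin : ∀ {n} {A : Set} {f : Fin n → List A} {b} → (∀ x → length (f x) ≤ b) →
                          length (concatMap f (allFin n)) ≤ n * b
length-concatMap-allFin {n} {b = b} f≤b =
  ≤-trans (length-concatMap≤ f≤b (allFin n)) (≤-reflexive (cong (_* b) (length-allFin n)))

length-smallSubsets : ∀ n k → length (smallSubsets {n} k) ≤ suc n ^ k
length-smallSubsets n zero    = ≤-refl
length-smallSubsets n (suc k) = begin
  length (smallSubsets k ++ concatMap (λ v → map (⁅ v ⁆ ∪_) (smallSubsets k)) (allFin n))
    ≡⟨ length-++ (smallSubsets k) ⟩
  length (smallSubsets {n} k) + length (concatMap (λ v → map (⁅ v ⁆ ∪_) (smallSubsets k)) (allFin n))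
    ≤⟨ +-mono-≤ (length-smallSubsets n k)
         (length-concatMap-allFin {f = λ v → map (⁅ v ⁆ ∪_) (smallSubsets k)} λ v →
            ≤-trans (≤-reflexive (length-map _ (smallSubsets k))) (length-smallSubsets n k)) ⟩
  suc n ^ suc k ∎
  where open ≤-Reasoning

x∉p-x : ∀ {n} (p : Subset n) {x} → x ∉ p - x
x∉p-x (_ ∷ p) {zero}  ()
x∉p-x (_ ∷ p) {suc x} (there x∈) = x∉p-x p x∈

remove-insert : ∀ {n} {p : Subset n} {v} → v ∈ p → ⁅ v ⁆ ∪ (p - v) ≡ p
remove-insert {p = p} {v} v∈p = ⊆-antisym to from
  where
  to : ⁅ v ⁆ ∪ (p - v) ⊆ p
  to x∈ with x∈p∪q⁻ ⁅ v ⁆ (p - v) x∈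
  ... | inj₁ x∈v = subst (_∈ p) (sym (x∈⁅y⁆⇒x≡y v x∈v)) v∈p
  ... | inj₂ x∈p = p─q⊆p p ⁅ v ⁆ x∈p
  from : p ⊆ ⁅ v ⁆ ∪ (p - v)
  from {x} x∈ with x ≟ v
  ... | yes refl = x∈p∪q⁺ (inj₁ (x∈⁅x⁆ v))
  ... | no x≢v   = x∈p∪q⁺ (inj₂ (x∈p∧x≢y⇒x∈p-y x∈ x≢v))

∈-smallSubsets : ∀ {n} k {p : Subset n} → ∣ p ∣ ≤ k → p ∈ₗ smallSubsets k
∈-smallSubsets k {p} ∣p∣≤k with nonempty? p
∈-smallSubsets zero    ∣p∣≤k | no empty = here (Empty-unique empty)
∈-smallSubsets {n} (suc k) {p} ∣p∣≤k | no empty = ∈-++⁺ˡ (∈-smallSubsets k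
  (≤-trans (≤-reflexive (trans (cong ∣_∣ (Empty-unique empty)) (∣⊥∣≡0 n))) z≤n))
∈-smallSubsets zero    {p} ∣p∣≤k | yes (v , v∈p) =
  contradiction (≤-trans (x∈p⇒∣p-x∣<∣p∣ v∈p) ∣p∣≤k) λ()
∈-smallSubsets (suc k) {p} ∣p∣≤k | yes (v , v∈p) = ∈-++⁺ʳ (smallSubsets k)
  (∈-concatMap (∈-allFin v) (subst (_∈ₗ map (⁅ v ⁆ ∪_) (smallSubsets k)) (remove-insert v∈p)
    (∈-map⁺ _ (∈-smallSubsets k (≤-pred (≤-trans (x∈p⇒∣p-x∣<∣p∣ v∈p) ∣p∣≤k))))))

module Counting {n : ℕ} (G : Graph n) where

  -- Empty for a non-edge, where c-closedness does not bound `nonNbrs u v`; so one length bound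
  -- holds for all pairs.
  nonNbrSubsets : Fin n → Fin n → List (Subset n)
  nonNbrSubsets u v = if adj G u v then subsets (nonNbrs G u v) else []

  ∈-nonNbrSubsets : ∀ {u v Y} → Edge G u v → Y ⊆ nonNbrs G u v → Y ∈ₗ nonNbrSubsets u v
  ∈-nonNbrSubsets {u} {v} uv Y⊆ with adj G u v
  ... | true = ∈-subsets Y⊆

  -- Maximal independent sets

  HasNbrIn : Subset n → Fin n → Set
  HasNbrIn I v = ∃[ y ] (y ∈ I × Edge G v y)

  hasNbrIn? : ∀ I v → Dec (HasNbrIn I v)
  hasNbrIn? I v = any? λ y → (y ∈? I) ×-dec T? (adj G v y)

  record MaximalIndependent (vs : List (Fin n)) (I : Subset n) : Set where
    field
      within      : ∀ {v} → v ∈ I → v ∈ₗ vs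
      independent : ∀ {u v} → u ∈ I → v ∈ I → ¬ Edge G u v
      dominating  : ∀ {z} → z ∈ₗ vs → z ∉ I → HasNbrIn I z

  -- Recovers `I` from `I - v` if the latter is maximal without `v`: then `v` belongs to `I` exactly
  -- when it has no neighbour there.
  extend : Fin n → Subset n → Subset n
  extend v I = if does (hasNbrIn? I v) then I else (⁅ v ⁆ ∪ I)

  extend-blocked : ∀ {v I} → HasNbrIn I v → extend v I ≡ I
  extend-blocked {v} {I} h rewrite dec-true (hasNbrIn? I v) h = refl

  extend-free : ∀ {v I} → ¬ HasNbrIn I v → extend v I ≡ ⁅ v ⁆ ∪ I
  extend-free {v} {I} ¬h rewrite dec-false (hasNbrIn? I v) ¬h = refl

  -- If I is maximal independent in v ∷ vs but I - v is not so in vs, then some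
  -- w has v as its only neighbour in I, whence I - v avoids the edge vw.
  independentSets : List (Fin n) → List (Subset n)
  independentSets []       = ⊥ ∷ []
  independentSets (v ∷ vs) =
    map (extend v) (independentSets vs) ++
    concatMap (λ w → map (⁅ v ⁆ ∪_) (nonNbrSubsets v w)) (allFin n)

  ∈-independentSets : ∀ {vs I} → Unique vs → MaximalIndependent vs I → I ∈ₗ independentSets vs
  ∈-independentSets {[]} _ max = here (Empty-unique λ (v , v∈) → contradiction (within v∈) λ())
    where open MaximalIndependent max
  ∈-independentSets {v ∷ vs} {I} (v∉ ∷ uniq) max with v ∈? I
  ... | no v∉I = ∈-++⁺ˡ (subst (_∈ₗ map (extend v) (independentSets vs))
          (extend-blocked (dominating (here refl) v∉I))
          (∈-map⁺ (extend v) (∈-independentSets uniq record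
            { within      = within′
            ; independent = independent
            ; dominating  = dominating ∘ there
            })))
    where
    open MaximalIndependent max
    within′ : ∀ {u} → u ∈ I → u ∈ₗ vs
    within′ u∈ with within u∈
    ... | here refl = contradiction u∈ v∉I
    ... | there u∈′ = u∈′
  ... | yes v∈I with any? (λ w → DecMembership._∈?_ _≟_ w vs ×-dec ¬? (w ∈? (I - v)) ×-dec ¬? (hasNbrIn? (I - v) w))
  ...   | no none = ∈-++⁺ˡ (subst (_∈ₗ map (extend v) (independentSets vs))
              (trans (extend-free (λ (y , y∈ , vy) → independent v∈I (J⊆I y∈) vy)) (remove-insert v∈I))
              (∈-map⁺ (extend v) (∈-independentSets uniq record
                { within      = within′
                ; independent = λ x∈ y∈ → independent (J⊆I x∈) (J⊆I y∈)
                ; dominating  = λ z∈ z∉ → decidable-stable (hasNbrIn? (I - v) _) λ ¬h → none (_ , z∈ , z∉ , ¬h)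
                })))
    where
    open MaximalIndependent max
    J⊆I : I - v ⊆ I
    J⊆I = p─q⊆p I ⁅ v ⁆
    within′ : ∀ {u} → u ∈ I - v → u ∈ₗ vs
    within′ u∈ with within (J⊆I u∈)
    ... | here refl = contradiction u∈ (x∉p-x I)
    ... | there u∈′ = u∈′
  ...   | yes (w , w∈vs , w∉J , ¬h) = ∈-++⁺ʳ (map (extend v) (independentSets vs))
              (∈-concatMap (∈-allFin w) (subst (_∈ₗ map (⁅ v ⁆ ∪_) (nonNbrSubsets v w)) (remove-insert v∈I)
                (∈-map⁺ _ (∈-nonNbrSubsets v-w λ y∈ → nonNbrs⁺ G (avoids-v y∈) (avoids-w y∈)))))
    where
    open MaximalIndependent max
    J⊆I : I - v ⊆ I
    J⊆I = p─q⊆p I ⁅ v ⁆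
    w≢v : w ≢ v
    w≢v refl = All.lookup v∉ w∈vs refl
    v-w : Edge G v w
    -- `w` has a neighbour in `I` but none in `I - v`, so that neighbour is `v`.
    v-w with dominating (there w∈vs) (λ w∈I → w∉J (x∈p∧x≢y⇒x∈p-y w∈I w≢v))
    ... | y , y∈ , wy with y ≟ v
    ...   | yes refl = edge-sym G wy
    ...   | no y≢v   = contradiction (y , x∈p∧x≢y⇒x∈p-y y∈ y≢v , wy) ¬h
    avoids-v : ∀ {y} → y ∈ I - v → ¬ Touches G v y
    avoids-v y∈ (inj₁ refl) = x∉p-x I y∈
    avoids-v y∈ (inj₂ vy)   = independent v∈I (J⊆I y∈) vy
    avoids-w : ∀ {y} → y ∈ I - v → ¬ Touches G w y
    avoids-w y∈ (inj₁ refl) = w∉J y∈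
    avoids-w y∈ (inj₂ wy)   = ¬h (_ , y∈ , wy)

  -- Lists of candidates

  splitCandidates : ℕ → List (Subset n)
  splitCandidates s =
    concatMap (λ u → concatMap (λ v → concatMap (λ x → concatMap (λ y →
      concatMap (λ A → concatMap (λ Y → map (λ Z → A ∪ (Y ∪ Z)) (nonNbrSubsets x y)) (nonNbrSubsets u v))
        (smallSubsets s)) (allFin n)) (allFin n)) (allFin n)) (allFin n)

  ∈-splitCandidates : ∀ {s S} → Split G s S → S ∈ₗ splitCandidates s
  ∈-splitCandidates {s} {S} sp =
    ∈-concatMap (∈-allFin u) (∈-concatMap (∈-allFin v) (∈-concatMap (∈-allFin x) (∈-concatMap (∈-allFin y)
      (∈-concatMap (∈-smallSubsets s ∣A∣≤s)
        (∈-concatMap (∈-nonNbrSubsets uv (p∩q⊆q S (nonNbrs G u v)))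
          (subst (_∈ₗ map (λ Z → A ∪ ((S ∩ nonNbrs G u v) ∪ Z)) (nonNbrSubsets x y))
            (⊆-antisym to from)
            (∈-map⁺ _ (∈-nonNbrSubsets xy (p∩q⊆q S (nonNbrs G x y))))))))))
    where
    open Split sp
    to : A ∪ ((S ∩ nonNbrs G u v) ∪ (S ∩ nonNbrs G x y)) ⊆ S
    to w∈ with x∈p∪q⁻ A _ w∈
    ... | inj₁ w∈A = A⊆S w∈A
    ... | inj₂ w∈′ = [ p∩q⊆p S _ , p∩q⊆p S _ ]′ (x∈p∪q⁻ (S ∩ nonNbrs G u v) _ w∈′)
    from : S ⊆ A ∪ ((S ∩ nonNbrs G u v) ∪ (S ∩ nonNbrs G x y))
    from {w} w∈S with w ∈? A
    ... | yes w∈A = x∈p∪q⁺ (inj₁ w∈A)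
    ... | no w∉A with rest w∈S w∉A
    ...   | inj₁ w∈ = x∈p∪q⁺ (inj₂ (x∈p∪q⁺ (inj₁ (x∈p∩q⁺ (w∈S , w∈)))))
    ...   | inj₂ w∈ = x∈p∪q⁺ (inj₂ (x∈p∪q⁺ (inj₂ (x∈p∩q⁺ (w∈S , w∈)))))

  -- The vertices of the graph in which `S ∖ B` is maximal independent. They are defined without
  -- `S`, so that `B` determines the graph.
  Attachable : ℕ → Subset n → Fin n → Set
  Attachable s B z = z ∉ B × ∣ nbrs G z ∩ B ∣ ≤ s

  attachable? : ∀ s B z → Dec (Attachable s B z)
  attachable? s B z = ¬? (z ∈? B) ×-dec (∣ nbrs G z ∩ B ∣ ≤? s)

  attachable : ℕ → Subset n → List (Fin n)
  attachable s B = filter (attachable? s B) (allFin n)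

  centredCandidates : ℕ → List (Subset n)
  centredCandidates s =
    concatMap (λ B → map (B ∪_) (independentSets (attachable s B))) (smallSubsets (suc s))

  module _ {f : ℕ → ℕ} {s : ℕ} (s≤f : ∀ r → 1 ≤ r → s ≤ f r) where

    ∈-centredCandidates : ∀ {S} → MaximalInClass f G S → Centred G s S → S ∈ₗ centredCandidates s
    ∈-centredCandidates {S} (_ , maximal) centred =
      ∈-concatMap (∈-smallSubsets (suc s) ∣B∣≤1+s)
        (subst (_∈ₗ map (B ∪_) (independentSets (attachable s B))) (⊆-antisym to from)
          (∈-map⁺ (B ∪_) (∈-independentSets (filter⁺ (attachable? s B) (allFin⁺ n)) record
            { within      = λ v∈ → let v∈S , v∉B = I⁻ v∈ in
                                   ∈-filter⁺ (attachable? s B) (∈-allFin _) (v∉B , fewNbrs v∈S v∉B)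
            ; independent = λ u∈ v∈ → independent (proj₁ (I⁻ u∈)) (proj₂ (I⁻ u∈)) (proj₁ (I⁻ v∈)) (proj₂ (I⁻ v∈))
            ; dominating  = dominating
            })))
      where
      open Centred centred
      I : Subset n
      I = S ∩ ∁ B
      I⁻ : ∀ {w} → w ∈ I → w ∈ S × w ∉ B
      I⁻ w∈ = let w∈S , w∈∁B = x∈p∩q⁻ S (∁ B) w∈ in w∈S , x∈∁p⇒x∉p w∈∁B
      I⁺ : ∀ {w} → w ∈ S → w ∉ B → w ∈ I
      I⁺ w∈S w∉B = x∈p∩q⁺ (w∈S , x∉p⇒x∈∁p w∉B)
      to : B ∪ I ⊆ S
      to w∈ = [ B⊆S , proj₁ ∘ I⁻ ]′ (x∈p∪q⁻ B I w∈)
      from : S ⊆ B ∪ I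
      from {w} w∈ with w ∈? B
      ... | yes w∈B = x∈p∪q⁺ (inj₁ w∈B)
      ... | no w∉B  = x∈p∪q⁺ (inj₂ (I⁺ w∈ w∉B))
      dominating : ∀ {z} → z ∈ₗ attachable s B → z ∉ I → HasNbrIn I z
      -- Otherwise `S ∪ ⁅ z ⁆` would still be centred at `B` and hence in the class.
      dominating {z} z∈ z∉I = decidable-stable (hasNbrIn? I z) λ none →
        let z∉B , few = proj₂ (∈-filter⁻ (attachable? s B) {xs = allFin n} z∈)
        in maximal (S ∪ ⁅ z ⁆)
             (p⊆p∪q ⁅ z ⁆ , z , q⊆p∪q S ⁅ z ⁆ (x∈⁅x⁆ z) , λ z∈S → z∉I (I⁺ z∈S z∉B))
             (centred⇒InClass G s≤f (centred-extend G centred z∉B few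
               λ y∈S y∉B zy → none (_ , I⁺ y∈S y∉B , zy)))

    -- `s` has two roles: as the value at a radius of at least four it bounds the width in the
    -- structure theorem, and as a lower bound of `f` it puts centred sets into the class.
    maximal⇒candidate : ∀ {r S} → 4 ≤ r → f r ≡ s → MaximalInClass f G S →
                        S ∈ₗ splitCandidates s ++ centredCandidates s
    maximal⇒candidate {r} {S} 4≤r refl max
      with locally-bounded⇒split-or-centred G S 4≤r (proj₁ max r)
    ... | inj₁ sp      = ∈-++⁺ˡ (∈-splitCandidates sp)
    ... | inj₂ centred = ∈-++⁺ʳ (splitCandidates s) (∈-centredCandidates max centred)

  -- Lengths of the lists

  module _ {c : ℕ} (closed : CoCClosed c G) where

    private
      D : ℕ
      D = 2 ^ (c ∸ 1)

    length-nonNbrSubsets : ∀ u v → length (nonNbrSubsets u v) ≤ D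
    length-nonNbrSubsets u v with adj G u v in eq
    ... | false = z≤n
    ... | true  = ≤-trans (≤-reflexive (length-subsets (nonNbrs G u v)))
      -- An edge of `G` is a pair of distinct vertices non-adjacent in the complement, so `closed`
      -- applies.
      (^-monoʳ-≤ 2 (closed u v (λ { refl → contradiction (trans (sym eq) (irrefl G u)) λ() })
        (cong (λ b → not b ∧ not ⌊ u ≟ v ⌋) eq)))

    -- `extend` preserves the number of sets, and each vertex `v` brings at most `D` new sets for
    -- every `w`.
    length-independentSets : ∀ vs → length (independentSets vs) ≤ 1 + length vs * (n * D)
    length-independentSets []       = ≤-refl
    length-independentSets (v ∷ vs) = begin
      length (map (extend v) (independentSets vs) ++ new)         ≡⟨ length-++ (map (extend v) (independentSets vs)) ⟩
      length (map (extend v) (independentSets vs)) + length new   ≡⟨ cong (_+ length new) (length-map _ (independentSets vs)) ⟩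
      length (independentSets vs) + length new                    ≤⟨ +-mono-≤ (length-independentSets vs) new≤ ⟩
      1 + length vs * (n * D) + n * D                             ≡⟨ cong suc (+-comm (length vs * (n * D)) (n * D)) ⟩
      1 + length (v ∷ vs) * (n * D)                               ∎
      where
      open ≤-Reasoning
      new : List (Subset n)
      new = concatMap (λ w → map (⁅ v ⁆ ∪_) (nonNbrSubsets v w)) (allFin n)
      new≤ : length new ≤ n * D
      new≤ = length-concatMap-allFin λ w →
        ≤-trans (≤-reflexive (length-map _ (nonNbrSubsets v w))) (length-nonNbrSubsets v w)

    length-splitCandidates : ∀ s → length (splitCandidates s) ≤ n * (n * (n * (n * (suc n ^ s * (D * D)))))
    length-splitCandidates s =
      length-concatMap-allFin λ u → length-concatMap-allFin λ v →
      length-concatMap-allFin λ x → length-concatMap-allFin λ y →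
      ≤-trans (length-concatMap≤ (λ A → ≤-trans
          (length-concatMap≤ (λ Y → ≤-trans (≤-reflexive (length-map _ (nonNbrSubsets x y))) (length-nonNbrSubsets x y))
            (nonNbrSubsets u v))
          (*-monoˡ-≤ D (length-nonNbrSubsets u v))) (smallSubsets s))
        (*-monoˡ-≤ (D * D) (length-smallSubsets n s))

    length-centredCandidates : ∀ s → length (centredCandidates s) ≤ suc n ^ suc s * (1 + n * (n * D))
    length-centredCandidates s =
      ≤-trans (length-concatMap≤ (λ B → ≤-trans (≤-reflexive (length-map _ (independentSets (attachable s B))))
          (≤-trans (length-independentSets (attachable s B))
            (s≤s (*-monoˡ-≤ (n * D) (≤-trans (length-filter (attachable? s B) (allFin n)) (≤-reflexive (length-allFin n)))))))
          (smallSubsets (suc s)))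
        (*-monoˡ-≤ (1 + n * (n * D)) (length-smallSubsets n (suc s)))

-- The least value exists but cannot be computed, hence the double negation.
eventual-minimum : ∀ (f : ℕ → ℕ) b k {r₀} → b ≤ r₀ → f r₀ ≤ k →
                   ¬ ¬ (∃[ r ] (b ≤ r × ∀ r′ → b ≤ r′ → f r ≤ f r′))
eventual-minimum f b k {r₀} b≤r₀ f≤k none = none (r₀ , b≤r₀ , least k f≤k)
  where
  least : ∀ k → f r₀ ≤ k → ∀ r′ → b ≤ r′ → f r₀ ≤ f r′
  least zero    f≤0   r′ b≤r′ = ≤-trans f≤0 z≤n
  least (suc k) f≤1+k r′ b≤r′ with f r₀ ≤? f r′
  ... | yes ≤r′ = ≤r′
  ... | no ≰r′  = contradiction none
    (eventual-minimum f b k b≤r′ (≤-pred (≤-trans (≰⇒> ≰r′) f≤1+k)))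

-- The final estimate

^-distribʳ-* : ∀ k m n → (m * n) ^ k ≡ m ^ k * n ^ k
^-distribʳ-* zero    m n = refl
^-distribʳ-* (suc k) m n =
  trans (cong (m * n *_) (^-distribʳ-* k m n)) ([m*n]*[o*p]≡[m*o]*[n*p] m n (m ^ k) (n ^ k))

-- The factor `2 ^ t` comes from `suc n ≤ 2 * n`. To the 5, split sets contribute 1 and centred sets
-- 2 · 2: one 2 from the extra factor `suc n`, one from the two summands.
candidates-bound : ∀ {s t} n d → 1 ≤ n → s ≤ t →
  n * (n * (n * (n * (suc n ^ s * (2 ^ d * 2 ^ d))))) + suc n ^ suc s * (1 + n * (n * 2 ^ d))
    ≤ 5 * 2 ^ t * n ^ (t + 4) * 4 ^ d
candidates-bound {s} {t} n@(suc _) d 1≤n s≤t = begin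
  n * (n * (n * (n * (suc n ^ s * (2 ^ d * 2 ^ d))))) + suc n * suc n ^ s * (1 + n * (n * 2 ^ d))
    ≤⟨ +-mono-≤ (*-monoʳ-≤ n (*-monoʳ-≤ n (*-monoʳ-≤ n (*-monoʳ-≤ n (*-mono-≤ powers (≤-reflexive squares))))))
                (*-mono-≤ (*-mono-≤ 1+n≤2n powers) (+-mono-≤ one≤ square≤)) ⟩
  n * (n * (n * (n * (P * Q * E)))) + 2 * n * (P * Q) * (n * n * n * E + n * n * n * E)
    ≡⟨ collect n P Q E ⟩
  5 * P * (Q * n ^ 4) * E
    ≡⟨ cong (λ m → 5 * P * m * E) (^-distribˡ-+-* n t 4) ⟨
  5 * P * n ^ (t + 4) * E ∎
  where
  open ≤-Reasoning
  P Q E : ℕ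
  P = 2 ^ t
  Q = n ^ t
  E = 4 ^ d
  squares : 2 ^ d * 2 ^ d ≡ E
  squares = sym (^-distribʳ-* d 2 2)
  1+n≤2n : suc n ≤ 2 * n
  1+n≤2n = ≤-trans (+-monoˡ-≤ n 1≤n) (≤-reflexive (cong (n +_) (sym (+-identityʳ n))))
  powers : suc n ^ s ≤ P * Q
  powers = ≤-trans (^-monoʳ-≤ (suc n) s≤t)
    (≤-trans (^-monoˡ-≤ t 1+n≤2n) (≤-reflexive (^-distribʳ-* t 2 n)))
  -- Both summands of `1 + n * (n * 2 ^ d)` are raised to `n * n * n * E`, to match the order of the
  -- split sets.
  one≤ : 1 ≤ n * n * n * E
  one≤ = *-mono-≤ (*-mono-≤ (*-mono-≤ 1≤n 1≤n) 1≤n) (m^n>0 4 d)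
  square≤ : n * (n * 2 ^ d) ≤ n * n * n * E
  square≤ = begin
    n * (n * 2 ^ d) ≡⟨ *-assoc n n (2 ^ d) ⟨
    n * n * 2 ^ d   ≤⟨ *-mono-≤ (m≤m*n (n * n) n) (^-monoˡ-≤ d (s≤s (s≤s z≤n))) ⟩
    n * n * n * E   ∎
  collect : ∀ n p q e → n * (n * (n * (n * (p * q * e)))) + 2 * n * (p * q) * (n * n * n * e + n * n * n * e)
                      ≡ 5 * p * (q * n ^ 4) * e
  collect = solve 4 (λ n p q e →
    n :* (n :* (n :* (n :* (p :* q :* e)))) :+ con 2 :* n :* (p :* q) :* (n :* n :* n :* e :+ n :* n :* n :* e)
      := con 5 :* p :* (q :* n :^ 4) :* e) refl
    where open +-*-Solver

theorem18 : (t : ℕ) → 1 ≤ t → (f : ℕ → ℕ) →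
    f 1 ≡ t → f 2 ≡ t → f 3 ≡ t → f 4 ≡ t → f 5 ≡ t →
    ∃[ K ] (∀ (c : ℕ) → 1 ≤ c → ∀ (n : ℕ) → 1 ≤ n → (G : Graph n) →
    CoCClosed c G →
    NumMaximalAtMost f G (K * (n ^ (t + 4)) * (4 ^ (c ∸ 1))))
theorem18 t _ f f1 f2 f3 f4 _ = 5 * 2 ^ t , λ c _ n 1≤n G closed L uniq maximal →
  -- The inequality is decidable, so a minimum given only up to double negation may be used.
  decidable-stable (_ ≤? _) λ exceeds →
  eventual-minimum f 4 t ≤-refl (≤-reflexive f4) λ (r , 4≤r , least) →
  exceeds (bound c n 1≤n G closed L uniq maximal r 4≤r least)
  where
  -- The minimum over radii from 4 on is at most `f 4`, which equals `f 1`, `f 2` and `f 3`; so it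
  -- bounds `f` at all positive radii.
  below : ∀ {r} → (∀ r′ → 4 ≤ r′ → f r ≤ f r′) → ∀ r′ → 1 ≤ r′ → f r ≤ f r′
  below least 1 _ = ≤-trans (least 4 ≤-refl) (≤-reflexive (trans f4 (sym f1)))
  below least 2 _ = ≤-trans (least 4 ≤-refl) (≤-reflexive (trans f4 (sym f2)))
  below least 3 _ = ≤-trans (least 4 ≤-refl) (≤-reflexive (trans f4 (sym f3)))
  below least (suc (suc (suc (suc r′)))) _ = least _ (s≤s (s≤s (s≤s (s≤s z≤n))))

  bound : ∀ c n → 1 ≤ n → (G : Graph n) → CoCClosed c G → ∀ L → Unique L → All (MaximalInClass f G) L →
          ∀ r → 4 ≤ r → (∀ r′ → 4 ≤ r′ → f r ≤ f r′) →
          length L ≤ 5 * 2 ^ t * n ^ (t + 4) * 4 ^ (c ∸ 1)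
  bound c n 1≤n G closed L uniq maximal r 4≤r least = begin
    length L
      ≤⟨ unique-⊆⇒length≤ uniq (λ S∈ → maximal⇒candidate (below least) 4≤r refl (All.lookup maximal S∈)) ⟩
    length (splitCandidates (f r) ++ centredCandidates (f r))
      ≡⟨ length-++ (splitCandidates (f r)) ⟩
    length (splitCandidates (f r)) + length (centredCandidates (f r))
      ≤⟨ +-mono-≤ (length-splitCandidates {c} closed (f r)) (length-centredCandidates {c} closed (f r)) ⟩
    -- By minimality `f r` is at most `f 4`, that is, `t`.
    _ ≤⟨ candidates-bound n (c ∸ 1) 1≤n (≤-trans (least 4 ≤-refl) (≤-reflexive f4)) ⟩
    5 * 2 ^ t * n ^ (t + 4) * 4 ^ (c ∸ 1) ∎
    where
    open ≤-Reasoning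
    open Counting G
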